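{- There exists a polynomial-time (many-one) reduction from the decision problem ForcingPM to the decision problem Anti-ForcingPM.
   Context: Graphs $G=(V(G),E(G))$ are finite, and edges are unordered pairs $\{u,v\}$ of distinct vertices. A perfect matching of $G$ is a set $M\subseteq E(G)$ such that every vertex is incident to exactly one edge of $M$. For a perfect matching $M$ of $G$, a forcing set of $M$ is an edge set $F\subseteq M$ such that no perfect matching of $G$ other than $M$ contains $F$; an anti-forcing set of $M$ is an edge set $A\subseteq E(G)\setminus M$ such that the graph $(V(G),E(G)\setminus A)$ has $M$ as its only perfect matching. ForcingPM: given a graph $G$ and a nonnegative integer $k$, decide whether there exists a perfect matching $M$ of $G$ that has a forcing set of size at most $k$. Anti-ForcingPM: given a graph $G$ and a nonnegative integer $k$, decide whether there exists a perfect matching $M$ of $G$ that has an anti-forcing set of size at most $k$. -}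

module Defs where

open import Data.Bool using (Bool; true; false)
open import Data.Fin using (Fin; toℕ) renaming (_<_ to _<ᶠ_)
open import Data.Fin.Properties using (toℕ-injective)
open import Data.Fin.Subset using (Subset; ∣_∣; ∁; ⊤) renaming (_∈_ to _∈ˢ_; _⊆_ to _⊆ˢ_)
open import Data.List using (List; []; _∷_; _++_; length; map; lookup)
open import Data.List.Properties using (∷-injectiveʳ)
open import Data.List.Relation.Unary.Unique.Propositional using (Unique)
open import Data.Maybe using (Maybe; just; nothing)
open import Data.Nat using (ℕ; zero; suc; _+_; _*_; _^_; _≤_)
open import Data.Nat.Binary using (ℕᵇ; 2[1+_]; 1+[2_]; fromℕ) renaming (zero to zeroᵇ)
open import Data.Nat.Binary.Properties using (fromℕ-injective)
open import Data.Product using (Σ-syntax; ∃-syntax; ∃!; _×_; _,_; proj₁; proj₂)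
open import Data.Sum using (_⊎_)
open import Data.Vec as Vec using (Vec; _∷_)
open import Function.Bundles using (_⇔_; _↔_)
open import Relation.Binary.PropositionalEquality using (_≡_; refl; cong; cong₂)

-- An unordered pair of distinct vertices is represented by listing its
-- smaller end first.
record Edge (n : ℕ) : Set where
  constructor edge
  field
    src tgt  : Fin n
    .src<tgt : src <ᶠ tgt

open Edge public

-- The edge set is given as a list without repetitions.
record Graph : Set where
  constructor graph
  field
    order   : ℕ
    edges   : List (Edge order)
    .unique : Unique edges

  Vertex : Set
  Vertex = Fin order

  size : ℕ
  size = length edges

  EdgeSet : Set
  EdgeSet = Subset size

  Incident : Vertex → Fin size → Set
  Incident v i = v ≡ src (lookup edges i) ⊎ v ≡ tgt (lookup edges i)

open Graph public

-- M is a perfect matching of the graph (V(G), S), where S ⊆ E(G).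
IsPerfectMatchingIn : (G : Graph) (S M : EdgeSet G) → Set
IsPerfectMatchingIn G S M =
  M ⊆ˢ S × (∀ v → ∃! _≡_ λ e → e ∈ˢ M × Incident G v e)

IsPerfectMatching : (G : Graph) (M : EdgeSet G) → Set
IsPerfectMatching G M = IsPerfectMatchingIn G ⊤ M

IsForcingSet : (G : Graph) (M F : EdgeSet G) → Set
IsForcingSet G M F =
  F ⊆ˢ M × (∀ N → IsPerfectMatching G N → F ⊆ˢ N → N ≡ M)

IsAntiForcingSet : (G : Graph) (M A : EdgeSet G) → Set
IsAntiForcingSet G M A =
  A ⊆ˢ ∁ M ×
  IsPerfectMatchingIn G (∁ A) M ×
  (∀ N → IsPerfectMatchingIn G (∁ A) N → N ≡ M)

-- A tape cell; `nothing` is the blank.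
Symbol : Set
Symbol = Maybe Bool

data Move : Set where
  left stay right : Move

-- A two-way infinite tape. `before` lists the cells to the left of the
-- head, nearest first; all cells not listed are blank.
record Tape : Set where
  constructor tape
  field
    before  : List Symbol
    current : Symbol
    after   : List Symbol

open Tape public

move : Move → Tape → Tape
move left  (tape []       c rs)       = tape [] nothing (c ∷ rs)
move left  (tape (l ∷ ls) c rs)       = tape ls l (c ∷ rs)
move stay  t                          = t
move right (tape ls       c [])       = tape (c ∷ ls) nothing []
move right (tape ls       c (r ∷ rs)) = tape (c ∷ ls) r rs

write : Symbol → Tape → Tape
write s t = record t { current = s }

act : Symbol × Move → Tape → Tape
act (s , m) t = move m (write s t)

blankTape : Tape
blankTape = tape [] nothing []

inputTape : List Bool → Tape
inputTape []       = blankTape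
inputTape (b ∷ bs) = tape [] (just b) (map just bs)

leadingBits : List Symbol → List Bool
leadingBits []             = []
leadingBits (nothing ∷ _)  = []
leadingBits (just b  ∷ ss) = b ∷ leadingBits ss

-- The word from the head up to the first blank.
contents : Tape → List Bool
contents t = leadingBits (current t ∷ after t)

record TuringMachine : Set₁ where
  field
    extraTapes : ℕ
    State      : Set
    stateCount : ℕ
    finite     : State ↔ Fin stateCount
    start      : State

  tapeCount : ℕ
  tapeCount = suc extraTapes

  -- The machine halts where the transition function gives `nothing`.
  field
    transition : State → Vec Symbol tapeCount →
                 Maybe (State × Vec (Symbol × Move) tapeCount)

  Config : Set
  Config = State × Vec Tape tapeCount

  perform : Vec Tape tapeCount →
            Maybe (State × Vec (Symbol × Move) tapeCount) → Maybe Config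
  perform ts nothing         = nothing
  perform ts (just (q , as)) = just (q , Vec.zipWith act as ts)

  step : Config → Maybe Config
  step (q , ts) = perform ts (transition q (Vec.map current ts))

  data HaltsIn : ℕ → Config → Config → Set where
    done : ∀ {c} → step c ≡ nothing → HaltsIn zero c c
    next : ∀ {t c c′ d} → step c ≡ just c′ → HaltsIn t c′ d → HaltsIn (suc t) c d

  -- The input is on the first tape, the output on the last.
  initial : List Bool → Config
  initial w = start , inputTape w ∷ Vec.replicate extraTapes blankTape

  output : Config → List Bool
  output (_ , ts) = contents (Vec.last ts)

  OutputsWithin : ℕ → List Bool → List Bool → Set
  OutputsWithin b w v =
    ∃[ t ] ∃[ d ] t ≤ b × HaltsIn t (initial w) d × output d ≡ v

record DecisionProblem : Set₁ where
  field
    Instance         : Set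
    encode           : Instance → List Bool
    encode-injective : ∀ {x y} → encode x ≡ encode y → x ≡ y
    Yes              : Instance → Set

open DecisionProblem public

PolyTimeComputable : (P Q : DecisionProblem) → (Instance P → Instance Q) → Set₁
PolyTimeComputable P Q f =
  Σ[ M ∈ TuringMachine ] ∃[ c ] ∃[ d ] ∀ x →
    TuringMachine.OutputsWithin M
      (c * length (encode P x) ^ d + c) (encode P x) (encode Q (f x))

infix 4 _≤ᵖ_

_≤ᵖ_ : (P Q : DecisionProblem) → Set₁
P ≤ᵖ Q =
  Σ[ f ∈ (Instance P → Instance Q) ]
    PolyTimeComputable P Q f × (∀ x → Yes P x ⇔ Yes Q (f x))

-- 1ⁿ0 followed by the given word.
unary : ℕ → List Bool → List Bool
unary zero    w = false ∷ w
unary (suc n) w = true ∷ unary n w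

-- Vertices are written in unary, so that the code of a graph has length
-- polynomial in its order, as for adjacency matrices. Every edge is
-- preceded by 1, and the end of the list is marked by 0.
encodeEdges : ∀ {n} → List (Edge n) → List Bool → List Bool
encodeEdges []       w = false ∷ w
encodeEdges (e ∷ es) w =
  true ∷ unary (toℕ (src e)) (unary (toℕ (tgt e)) (encodeEdges es w))

-- Bijective base-2 numeration, least significant digit first: the digits
-- 1 and 2 are written as 0 and 1.
digits : ℕᵇ → List Bool
digits zeroᵇ    = []
digits 2[1+ n ] = true ∷ digits n
digits 1+[2 n ] = false ∷ digits n

encodeGraph×ℕ : Graph × ℕ → List Bool
encodeGraph×ℕ (G , k) =
  unary (order G) (encodeEdges (edges G) (digits (fromℕ k)))

unary-injective : ∀ m n {v w} → unary m v ≡ unary n w → m ≡ n × v ≡ w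
unary-injective zero    zero    refl = refl , refl
unary-injective (suc m) (suc n) eq   with unary-injective m n (∷-injectiveʳ eq)
... | refl , eq′ = refl , eq′

encodeEdges-injective : ∀ {n} (es fs : List (Edge n)) {v w} →
  encodeEdges es v ≡ encodeEdges fs w → es ≡ fs × v ≡ w
encodeEdges-injective []       []       refl = refl , refl
encodeEdges-injective (e ∷ es) (f ∷ fs) eq
  with unary-injective (toℕ (src e)) (toℕ (src f)) (∷-injectiveʳ eq)
... | s , eq₁ with unary-injective (toℕ (tgt e)) (toℕ (tgt f)) eq₁
... | t , eq₂ with encodeEdges-injective es fs eq₂ | toℕ-injective s | toℕ-injective t
... | refl , eq₃ | refl | refl = refl , eq₃

digits-injective : ∀ x y → digits x ≡ digits y → x ≡ y
digits-injective zeroᵇ     zeroᵇ     _  = refl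
digits-injective 2[1+ x ]  2[1+ y ]  eq = cong 2[1+_] (digits-injective x y (∷-injectiveʳ eq))
digits-injective 1+[2 x ] 1+[2 y ] eq = cong 1+[2_] (digits-injective x y (∷-injectiveʳ eq))

encodeGraph×ℕ-injective : ∀ {x y} → encodeGraph×ℕ x ≡ encodeGraph×ℕ y → x ≡ y
encodeGraph×ℕ-injective {graph m es _ , k} {graph n fs _ , l} eq
  with unary-injective m n eq
... | refl , eq₁ with encodeEdges-injective es fs eq₁
... | refl , eq₂ with fromℕ-injective {k} {l} (digits-injective _ _ eq₂)
... | refl = refl

ForcingPM : DecisionProblem
ForcingPM = record
  { Instance         = Graph × ℕ
  ; encode           = encodeGraph×ℕ
  ; encode-injective = encodeGraph×ℕ-injective
  ; Yes              = λ (G , k) → ∃[ M ] IsPerfectMatching G M ×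
                         ∃[ F ] IsForcingSet G M F × ∣ F ∣ ≤ k
  }

Anti-ForcingPM : DecisionProblem
Anti-ForcingPM = record
  { Instance         = Graph × ℕ
  ; encode           = encodeGraph×ℕ
  ; encode-injective = encodeGraph×ℕ-injective
  ; Yes              = λ (G , k) → ∃[ M ] IsPerfectMatching G M ×
                         ∃[ A ] IsAntiForcingSet G M A × ∣ A ∣ ≤ k
  }

{-# OPTIONS --safe #-}

-- Replace every edge uv of G by a path u — a — b — v of three edges and keep
-- k. Perfect matchings M of G correspond to perfect matchings M′ of the new
-- graph: uv ∈ M iff ua, bv ∈ M′ iff ab ∉ M′. Deleting ab forces uv into the
-- matching, so a forcing set yields an anti-forcing set of the same size.
-- Conversely, an edge ab ∉ M′ of an anti-forcing set is replaced by uv ∈ M,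
-- and an edge ua ∉ M′ (or bv) by the edge of M at u (at v), which already
-- excludes uv.
--
-- A three-tape machine computes the new graph in quadratic time. It keeps the
-- number c of vertices used so far in unary on its second tape and writes,
-- for each edge uv, the edges (u,c), (c,c+1), (v,c+1), in this order so that
-- the counter is read once in alternating directions. The new order, known
-- only at the end, is put in front of the output by moving left.
module Submission where

open import Defs

open import Data.Bool using (Bool; true; false; not)
open import Data.Empty using (⊥-elim-irr)
open import Data.Fin using (Fin; zero; suc; toℕ; _↑ˡ_; _↑ʳ_; combine; remQuot; splitAt)
  renaming (_<_ to _<ᶠ_)
open import Data.Fin.Properties
  using (<⇒≢; toℕ<n; toℕ-↑ˡ; toℕ-↑ʳ; toℕ-combine; ↑ˡ-injective; ↑ʳ-injective;
         combine-injective; combine-remQuot; splitAt⁻¹-↑ˡ; splitAt⁻¹-↑ʳ)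
open import Data.Fin.Subset
  using (Subset; inside; outside; ∣_∣; ∁; ⊥; ⁅_⁆; _∪_; _∈_; _∉_; _⊆_)
open import Data.Fin.Subset.Properties
  using (∣⊥∣≡0; ∣⁅x⁆∣≡1; x∈⁅x⁆; x∈⁅y⁆⇒x≡y; x∈p∪q⁺; x∈p∪q⁻; ∉⊥; _∈?_; ⊆⊤; ⊆-antisym;
         x∉p⇒x∈∁p; x∈∁p⇒x∉p)
open import Data.List using (List; []; _∷_; _++_; length; lookup; map; replicate; _ʳ++_)
open import Data.List.Relation.Unary.All using (All; []; _∷_)
open import Data.List.Relation.Unary.AllPairs using ([]; _∷_)
open import Data.List.Relation.Unary.Unique.Propositional using (Unique)
open import Data.Maybe using (Maybe; just; nothing)
open import Data.Nat using (ℕ; zero; suc; _+_; _*_; _^_; _≤_; z≤n; s≤s)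
open import Data.Nat.Binary using (fromℕ)
open import Data.Nat.Properties
  using (≤-refl; ≤-trans; ≤-reflexive; <-≤-trans; n≤1+n; m≤m+n; m≤n+m; m≤m*n; m≤n⇒m≤1+n;
         +-suc; +-comm; +-identityʳ; +-mono-≤; +-monoˡ-≤; +-monoʳ-≤; +-monoʳ-<;
         *-mono-≤; *-monoˡ-≤; *-monoʳ-≤; module ≤-Reasoning)
open import Data.Nat.Tactic.RingSolver using (solve-∀)
open import Data.Product using (∃-syntax; ∃!; _×_; _,_; proj₁; proj₂; map₁; uncurry)
open import Data.Sum using (_⊎_; inj₁; inj₂)
open import Data.Vec as Vec using (Vec; []; _∷_; here; there)
open import Data.Vec.Properties using ([]=⇒lookup; lookup⇒[]=; lookup∘tabulate)
open import Function using (_∘_; _⇔_; mk⇔)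
open import Function.Construct.Identity using (↔-id)
open import Relation.Binary.PropositionalEquality
  using (_≡_; _≢_; refl; sym; trans; cong; subst)
open import Relation.Nullary using (yes; no; contradiction)

-- Sizes of unions and images of finite sets

∣p∪q∣≤∣p∣+∣q∣ : ∀ {n} (p q : Subset n) → ∣ p ∪ q ∣ ≤ ∣ p ∣ + ∣ q ∣
∣p∪q∣≤∣p∣+∣q∣ []            []            = z≤n
∣p∪q∣≤∣p∣+∣q∣ (outside ∷ p) (outside ∷ q) = ∣p∪q∣≤∣p∣+∣q∣ p q
∣p∪q∣≤∣p∣+∣q∣ (outside ∷ p) (inside ∷ q)  =
  ≤-trans (s≤s (∣p∪q∣≤∣p∣+∣q∣ p q)) (≤-reflexive (sym (+-suc ∣ p ∣ ∣ q ∣)))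
∣p∪q∣≤∣p∣+∣q∣ (inside ∷ p)  (outside ∷ q) = s≤s (∣p∪q∣≤∣p∣+∣q∣ p q)
∣p∪q∣≤∣p∣+∣q∣ (inside ∷ p)  (inside ∷ q)  =
  s≤s (≤-trans (∣p∪q∣≤∣p∣+∣q∣ p q) (+-monoʳ-≤ ∣ p ∣ (n≤1+n ∣ q ∣)))

image : ∀ {m n} → (Fin m → Fin n) → Subset m → Subset n
image φ []            = ⊥
image φ (outside ∷ p) = image (φ ∘ suc) p
image φ (inside ∷ p)  = ⁅ φ zero ⁆ ∪ image (φ ∘ suc) p

-- Only an upper bound is available: φ need not be injective, as several edges of an anti-forcing
-- set may have the same guard.
∣image∣≤ : ∀ {m n} (φ : Fin m → Fin n) p → ∣ image φ p ∣ ≤ ∣ p ∣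
∣image∣≤ {n = n} φ [] = ≤-reflexive (∣⊥∣≡0 n)
∣image∣≤ φ (outside ∷ p) = ∣image∣≤ (φ ∘ suc) p
∣image∣≤ φ (inside ∷ p)  = ≤-trans (∣p∪q∣≤∣p∣+∣q∣ ⁅ φ zero ⁆ _)
  (+-mono-≤ (≤-reflexive (∣⁅x⁆∣≡1 (φ zero))) (∣image∣≤ (φ ∘ suc) p))

∈-image⁺ : ∀ {m n} (φ : Fin m → Fin n) {p x} → x ∈ p → φ x ∈ image φ p
∈-image⁺ φ here = x∈p∪q⁺ (inj₁ (x∈⁅x⁆ (φ zero)))
∈-image⁺ φ {outside ∷ p} (there x∈p) = ∈-image⁺ (φ ∘ suc) x∈p
∈-image⁺ φ {inside ∷ p}  (there x∈p) = x∈p∪q⁺ (inj₂ (∈-image⁺ (φ ∘ suc) x∈p))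

∈-image⁻ : ∀ {m n} (φ : Fin m → Fin n) p {y} → y ∈ image φ p → ∃[ x ] x ∈ p × φ x ≡ y
∈-image⁻ φ []            y∈ = contradiction y∈ ∉⊥
∈-image⁻ φ (outside ∷ p) y∈ with ∈-image⁻ (φ ∘ suc) p y∈
... | x , x∈p , eq = suc x , there x∈p , eq
∈-image⁻ φ (inside ∷ p)  y∈ with x∈p∪q⁻ ⁅ φ zero ⁆ _ y∈
... | inj₁ y∈φ0 = zero , here , sym (x∈⁅y⁆⇒x≡y _ y∈φ0)
... | inj₂ y∈φp with ∈-image⁻ (φ ∘ suc) p y∈φp
...   | x , x∈p , eq = suc x , there x∈p , eq

-- The subdivided graph

Side : Set
Side = Fin 2

-- The edge between the two ends src, tgt becomes the path
-- src —outer 0— • —inner— • —outer 1— tgt.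
data Part : Set where
  outer : Side → Part
  inner : Part

end : ∀ {n} → Edge n → Side → Fin n
end e zero       = src e
end e (suc zero) = tgt e

end-injective : ∀ {n} (e : Edge n) s t → end e s ≡ end e t → s ≡ t
end-injective e zero       zero       eq = refl
end-injective (edge _ _ src<tgt) zero       (suc zero) eq = ⊥-elim-irr (<⇒≢ src<tgt eq)
end-injective (edge _ _ src<tgt) (suc zero) zero       eq = ⊥-elim-irr (<⇒≢ src<tgt (sym eq))
end-injective e (suc zero) (suc zero) eq = refl

private
  variable
    A : Set
    m : ℕ

-- The order within each triple is the one in which the machine writes the three edges, so that the
-- two codes agree bit by bit.
flatten : (Fin m → Part → A) → List A
flatten {zero}  h = []
flatten {suc m} h =
  h zero (outer zero) ∷ h zero inner ∷ h zero (outer (suc zero)) ∷ flatten (h ∘ suc)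

pos : (h : Fin m → Part → A) → Fin m → Part → Fin (length (flatten h))
pos h zero    (outer zero)       = zero
pos h zero    inner              = suc zero
pos h zero    (outer (suc zero)) = suc (suc zero)
pos h (suc i) p                  = suc (suc (suc (pos (h ∘ suc) i p)))

lookup-pos : (h : Fin m → Part → A) → ∀ i p → lookup (flatten h) (pos h i p) ≡ h i p
lookup-pos h zero    (outer zero)       = refl
lookup-pos h zero    inner              = refl
lookup-pos h zero    (outer (suc zero)) = refl
lookup-pos h (suc i) p                  = lookup-pos (h ∘ suc) i p

unpos : (h : Fin m → Part → A) → Fin (length (flatten h)) → Fin m × Part
unpos {suc m} h zero             = zero , outer zero
unpos {suc m} h (suc zero)       = zero , inner
unpos {suc m} h (suc (suc zero)) = zero , outer (suc zero)
unpos {suc m} h (suc (suc (suc k))) = map₁ suc (unpos (h ∘ suc) k)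

unpos-pos : (h : Fin m → Part → A) → ∀ i p → unpos h (pos h i p) ≡ (i , p)
unpos-pos h zero    (outer zero)       = refl
unpos-pos h zero    inner              = refl
unpos-pos h zero    (outer (suc zero)) = refl
unpos-pos h (suc i) p                  = cong (map₁ suc) (unpos-pos (h ∘ suc) i p)

pos-unpos : (h : Fin m → Part → A) → ∀ k → uncurry (pos h) (unpos h k) ≡ k
pos-unpos {suc m} h zero                = refl
pos-unpos {suc m} h (suc zero)          = refl
pos-unpos {suc m} h (suc (suc zero))    = refl
pos-unpos {suc m} h (suc (suc (suc k))) = cong (λ k → suc (suc (suc k))) (pos-unpos (h ∘ suc) k)

All-flatten : {P : A → Set} (h : Fin m → Part → A) → (∀ i p → P (h i p)) → All P (flatten h)
All-flatten {m = zero}  h all = []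
All-flatten {m = suc m} h all =
  all _ _ ∷ all _ _ ∷ all _ _ ∷ All-flatten (h ∘ suc) (all ∘ suc)

Unique-flatten : (h : Fin m → Part → A) →
  (∀ i p j q → h i p ≡ h j q → (i , p) ≡ (j , q)) → Unique (flatten h)
Unique-flatten {m = zero}  h inj = []
Unique-flatten {m = suc m} h inj =
  (apart (λ ()) ∷ apart (λ ()) ∷ fresh) ∷ (apart (λ ()) ∷ fresh) ∷ fresh ∷
  Unique-flatten (h ∘ suc) (λ i p j q eq → lower (inj (suc i) p (suc j) q eq))
  where
    apart : ∀ {i p j q} → (i , p) ≢ (j , q) → h i p ≢ h j q
    apart ≢ eq = ≢ (inj _ _ _ _ eq)
    fresh : ∀ {p} → All (h zero p ≢_) (flatten (h ∘ suc))
    fresh = All-flatten (h ∘ suc) (λ i q → apart (λ ()))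
    lower : ∀ {i p j q} → (suc i , p) ≡ (suc j , q) → (i , p) ≡ (j , q)
    lower refl = refl

module Subdivision {n : ℕ} (es : List (Edge n)) where

  order′ : ℕ
  order′ = n + length es * 2

  old : Fin n → Fin order′
  old v = v ↑ˡ (length es * 2)

  -- `combine i s` is numbered 2i + s, so each edge takes the next two consecutive numbers after the
  -- old vertices, as the machine's counter does.
  new : Fin (length es) → Side → Fin order′
  new i s = n ↑ʳ combine i s

  toℕ-new : ∀ i s → toℕ (new i s) ≡ n + (2 * toℕ i + toℕ s)
  toℕ-new i s = trans (toℕ-↑ʳ n _) (cong (n +_) (toℕ-combine i s))

  old<new : ∀ v i s → old v <ᶠ new i s
  old<new v i s rewrite toℕ-↑ˡ v (length es * 2) | toℕ-↑ʳ n (combine i s) =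
    <-≤-trans (toℕ<n v) (m≤m+n n _)

  old≢new : ∀ {v i s} → old v ≢ new i s
  old≢new {v} {i} {s} eq = <⇒≢ (old<new v i s) eq

  new<new : ∀ i → new i zero <ᶠ new i (suc zero)
  new<new i rewrite toℕ-new i zero | toℕ-new i (suc zero) =
    +-monoʳ-< n (+-monoʳ-< (2 * toℕ i) ≤-refl)

  old-injective : ∀ {u v} → old u ≡ old v → u ≡ v
  old-injective = ↑ˡ-injective (length es * 2) _ _

  new-injective : ∀ {i s j t} → new i s ≡ new j t → (i , s) ≡ (j , t)
  new-injective {i} {s} {j} {t} eq with combine-injective i s j t (↑ʳ-injective n _ _ eq)
  ... | refl , refl = refl

  data Origin : Fin order′ → Set where
    isOld : ∀ v → Origin (old v)
    isNew : ∀ i s → Origin (new i s)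

  origin : ∀ v → Origin v
  origin v with splitAt n v in eq
  ... | inj₁ u = subst Origin (splitAt⁻¹-↑ˡ eq) (isOld u)
  ... | inj₂ j = subst Origin (trans (cong (n ↑ʳ_) (combine-remQuot {length es} 2 j)) (splitAt⁻¹-↑ʳ eq))
                   (isNew (proj₁ (remQuot {length es} 2 j)) (proj₂ (remQuot {length es} 2 j)))

  newEdge : Fin (length es) → Part → Edge order′
  newEdge i (outer s) = edge (old (end (lookup es i) s)) (new i s) (old<new _ i s)
  newEdge i inner     = edge (new i zero) (new i (suc zero)) (new<new i)

  -- The new end of an outer edge already determines both the original edge and the side.
  newEdge-injective : ∀ i p j q → newEdge i p ≡ newEdge j q → (i , p) ≡ (j , q)
  newEdge-injective i (outer s) j (outer t) eq with new-injective (cong tgt eq)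
  ... | refl = refl
  newEdge-injective i (outer s) j inner     eq = contradiction (cong src eq) old≢new
  newEdge-injective i inner     j (outer t) eq = contradiction (sym (cong src eq)) old≢new
  newEdge-injective i inner     j inner     eq with new-injective {s = zero} {t = zero} (cong src eq)
  ... | refl = refl

  edges′ : List (Edge order′)
  edges′ = flatten newEdge

subdivide : Graph → Graph
subdivide (graph n es _) = graph order′ edges′ (Unique-flatten newEdge newEdge-injective)
  where open Subdivision es

-- Perfect matchings of a graph and of its subdivision

∈-tabulate⁺ : ∀ {n} (f : Fin n → Bool) {x} → f x ≡ true → x ∈ Vec.tabulate f
∈-tabulate⁺ f {x} eq = lookup⇒[]= x _ (trans (lookup∘tabulate f x) eq)

∈-tabulate⁻ : ∀ {n} (f : Fin n → Bool) {x} → x ∈ Vec.tabulate f → f x ≡ true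
∈-tabulate⁻ f {x} x∈ = trans (sym (lookup∘tabulate f x)) ([]=⇒lookup x∈)

module Correctness (G : Graph) where

  open Subdivision (edges G)

  private
    G′ : Graph
    G′ = subdivide G

  ends : Fin (size G) → Side → Vertex G
  ends i = end (lookup (edges G) i)

  Perfect : (H : Graph) → EdgeSet H → Set
  Perfect H M = ∀ v → ∃! _≡_ λ e → e ∈ M × Incident H v e

  end⇒Incident : ∀ i s → Incident G (ends i s) i
  end⇒Incident i zero       = inj₁ refl
  end⇒Incident i (suc zero) = inj₂ refl

  Incident⇒end : ∀ {v i} → Incident G v i → ∃[ s ] v ≡ ends i s
  Incident⇒end (inj₁ eq) = zero , eq
  Incident⇒end (inj₂ eq) = suc zero , eq

  at : Fin (size G) → Part → Fin (size G′)
  at = pos newEdge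

  at-injective : ∀ {i p j q} → at i p ≡ at j q → (i , p) ≡ (j , q)
  at-injective {i} {p} {j} {q} eq =
    trans (sym (unpos-pos newEdge i p)) (trans (cong (unpos newEdge) eq) (unpos-pos newEdge j q))

  data Location : Fin (size G′) → Set where
    located : ∀ i p → Location (at i p)

  locate : ∀ k → Location k
  locate k = subst Location (pos-unpos newEdge k) (located _ _)

  -- Incidence in the subdivision as an inductive family, equivalent to `Incident G′` by the next
  -- two lemmas and open to case analysis.
  data Meets : Vertex G′ → Fin (size G) → Part → Set where
    atEnd   : ∀ i s → Meets (old (ends i s)) i (outer s)
    atOuter : ∀ i s → Meets (new i s) i (outer s)
    atInner : ∀ i s → Meets (new i s) i inner

  Meets⇒Incident : ∀ {v i p} → Meets v i p → Incident G′ v (at i p)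
  Meets⇒Incident {i = i} {p} meets rewrite lookup-pos newEdge i p = go meets
    where
      go : ∀ {v i p} → Meets v i p → v ≡ src (newEdge i p) ⊎ v ≡ tgt (newEdge i p)
      go (atEnd i s)            = inj₁ refl
      go (atOuter i s)          = inj₂ refl
      go (atInner i zero)       = inj₁ refl
      go (atInner i (suc zero)) = inj₂ refl

  Incident⇒Meets : ∀ {v} i p → Incident G′ v (at i p) → Meets v i p
  Incident⇒Meets i p inc rewrite lookup-pos newEdge i p = go p inc
    where
      go : ∀ {v} p → v ≡ src (newEdge i p) ⊎ v ≡ tgt (newEdge i p) → Meets v i p
      go (outer s) (inj₁ refl) = atEnd i s
      go (outer s) (inj₂ refl) = atOuter i s
      go inner     (inj₁ refl) = atInner i zero
      go inner     (inj₂ refl) = atInner i (suc zero)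

  -- The vertex is a variable tied by an equation, so that Meets can be matched on.
  old-meets : ∀ {v u i p} → v ≡ old u → Meets v i p → ∃[ s ] p ≡ outer s × u ≡ ends i s
  old-meets eq (atEnd i s)   = s , refl , old-injective (sym eq)
  old-meets eq (atOuter i s) = contradiction (sym eq) old≢new
  old-meets eq (atInner i s) = contradiction (sym eq) old≢new

  new-meets : ∀ {v i j s p} → v ≡ new i s → Meets v j p → j ≡ i × (p ≡ outer s ⊎ p ≡ inner)
  new-meets eq (atEnd j t)   = contradiction eq old≢new
  new-meets eq (atOuter j t) with new-injective eq
  ... | refl = refl , inj₁ refl
  new-meets eq (atInner j t) with new-injective eq
  ... | refl = refl , inj₂ refl

  unique-edge : ∀ {M v e f} → Perfect G M → e ∈ M → Incident G v e → f ∈ M → Incident G v f → e ≡ f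
  unique-edge {v = v} perfect e∈ v∈e f∈ v∈f with perfect v
  ... | _ , _ , only = trans (sym (only (e∈ , v∈e))) (only (f∈ , v∈f))

  unique-part : ∀ {M v i p j q} → Perfect G′ M →
    at i p ∈ M → Meets v i p → at j q ∈ M → Meets v j q → (i , p) ≡ (j , q)
  unique-part {v = v} perfect i∈ vi j∈ vj with perfect v
  ... | _ , _ , only = at-injective
    (trans (sym (only (i∈ , Meets⇒Incident vi))) (only (j∈ , Meets⇒Incident vj)))

  cover : ∀ {M} → Perfect G′ M → ∀ v → ∃[ i ] ∃[ p ] at i p ∈ M × Meets v i p
  cover perfect v with perfect v
  ... | k , (k∈ , inc) , _ with locate k
  ...   | located i p = i , p , k∈ , Incident⇒Meets i p inc

  perfect′ : ∀ {M} → (∀ v → ∃[ i ] ∃[ p ] (at i p ∈ M × Meets v i p ×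
    (∀ {j q} → at j q ∈ M → Meets v j q → (i , p) ≡ (j , q)))) → Perfect G′ M
  perfect′ {M} cover v with cover v
  ... | i , p , i∈ , vi , only = at i p , (i∈ , Meets⇒Incident vi) , only′ (locate _)
    where
      only′ : ∀ {k} → Location k → k ∈ M × Incident G′ v k → at i p ≡ k
      only′ (located j q) (j∈ , inc) = cong (uncurry at) (only j∈ (Incident⇒Meets j q inc))

  lift-part : EdgeSet G → Fin (size G) × Part → Bool
  lift-part M (i , outer _) = Vec.lookup M i
  lift-part M (i , inner)   = not (Vec.lookup M i)

  lift : EdgeSet G → EdgeSet G′
  lift M = Vec.tabulate (lift-part M ∘ unpos newEdge)

  -- Side 0 is an arbitrary choice: a perfect matching contains either both outer edges of a path or
  -- neither.
  lower : EdgeSet G′ → EdgeSet G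
  lower M = Vec.tabulate λ i → Vec.lookup M (at i (outer zero))

  lift-at⁺ : ∀ M {i p} → lift-part M (i , p) ≡ true → at i p ∈ lift M
  lift-at⁺ M {i} {p} eq = ∈-tabulate⁺ _ (trans (cong (lift-part M) (unpos-pos newEdge i p)) eq)

  lift-at⁻ : ∀ M {i p} → at i p ∈ lift M → lift-part M (i , p) ≡ true
  lift-at⁻ M {i} {p} i∈ = trans (cong (lift-part M) (sym (unpos-pos newEdge i p))) (∈-tabulate⁻ _ i∈)

  outer∈lift⁺ : ∀ M {i} s → i ∈ M → at i (outer s) ∈ lift M
  outer∈lift⁺ M s i∈ = lift-at⁺ M ([]=⇒lookup i∈)

  outer∈lift⁻ : ∀ M {i s} → at i (outer s) ∈ lift M → i ∈ M
  outer∈lift⁻ M i∈ = lookup⇒[]= _ M (lift-at⁻ M i∈)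

  inner∈lift⁺ : ∀ M {i} → i ∉ M → at i inner ∈ lift M
  inner∈lift⁺ M {i} i∉ = lift-at⁺ M (go (Vec.lookup M i) refl)
    where
      go : ∀ b → Vec.lookup M i ≡ b → not b ≡ true
      go true  eq = contradiction (lookup⇒[]= i M eq) i∉
      go false eq = refl

  inner∈lift⁻ : ∀ M {i} → at i inner ∈ lift M → i ∉ M
  inner∈lift⁻ M i∈ i∈M with trans (cong not (sym ([]=⇒lookup i∈M))) (lift-at⁻ M i∈)
  ... | ()

  -- An old vertex is covered by the outer edge at its end of its matching edge; a new vertex of the
  -- path of i by its outer edge if i ∈ M, and by the inner edge otherwise.
  lift-perfect : ∀ {M} → Perfect G M → Perfect G′ (lift M)
  lift-perfect {M} perfect = perfect′ (λ v → go (origin v))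
    where
      go : ∀ {v} → Origin v → ∃[ i ] ∃[ p ] (at i p ∈ lift M × Meets v i p ×
        (∀ {j q} → at j q ∈ lift M → Meets v j q → (i , p) ≡ (j , q)))
      go (isOld u) with perfect u
      ... | i , (i∈ , inc) , only with Incident⇒end inc
      ... | s , refl = i , outer s , outer∈lift⁺ M s i∈ , atEnd i s , only′
        where
          only′ : ∀ {j q} → at j q ∈ lift M → Meets (old (ends i s)) j q → (i , outer s) ≡ (j , q)
          only′ {j} j∈ meets with old-meets refl meets
          ... | t , refl , eq
            with only (outer∈lift⁻ M j∈ , subst (λ u → Incident G u j) (sym eq) (end⇒Incident j t))
          -- The two ends of an edge are distinct, so the path of i meets this old vertex on one
          -- side only.
          ... | refl with end-injective (lookup (edges G) i) s t eq
          ... | refl = refl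
      go (isNew i s) with i ∈? M
      ... | yes i∈ = i , outer s , outer∈lift⁺ M s i∈ , atOuter i s , only′
        where
          only′ : ∀ {j q} → at j q ∈ lift M → Meets (new i s) j q → (i , outer s) ≡ (j , q)
          only′ j∈ meets with new-meets refl meets
          ... | refl , inj₁ refl = refl
          ... | refl , inj₂ refl = contradiction i∈ (inner∈lift⁻ M j∈)
      ... | no i∉ = i , inner , inner∈lift⁺ M i∉ , atInner i s , only′
        where
          only′ : ∀ {j q} → at j q ∈ lift M → Meets (new i s) j q → (i , inner) ≡ (j , q)
          only′ j∈ meets with new-meets refl meets
          ... | refl , inj₁ refl = contradiction (outer∈lift⁻ M j∈) i∉
          ... | refl , inj₂ refl = refl

  lower-lift : ∀ M → lower (lift M) ≡ M
  lower-lift M = ⊆-antisym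
    (λ i∈ → outer∈lift⁻ M (lookup⇒[]= _ (lift M) (∈-tabulate⁻ _ i∈)))
    (λ i∈ → ∈-tabulate⁺ _ ([]=⇒lookup (outer∈lift⁺ M zero i∈)))

  module _ {M : EdgeSet G′} (perfect : Perfect G′ M) where

    outer⇒¬inner : ∀ {i s} → at i (outer s) ∈ M → at i inner ∉ M
    outer⇒¬inner {i} {s} o∈ i∈ with unique-part perfect o∈ (atOuter i s) i∈ (atInner i s)
    ... | ()

    -- The new vertex `new i s` lies on just these two edges, and one of them must cover it.
    ¬inner⇒outer : ∀ {i} s → at i inner ∉ M → at i (outer s) ∈ M
    ¬inner⇒outer {i} s i∉ with cover perfect (new i s)
    ... | j , q , j∈ , meets with new-meets refl meets
    ...   | refl , inj₁ refl = j∈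
    ...   | refl , inj₂ refl = contradiction j∈ i∉

    outer∈⇒∈lower : ∀ {i s} → at i (outer s) ∈ M → i ∈ lower M
    outer∈⇒∈lower o∈ = ∈-tabulate⁺ _ ([]=⇒lookup (¬inner⇒outer zero (outer⇒¬inner o∈)))

    -- The absence of the inner edge carries membership from side 0, by which `lower` is defined, to
    -- either side.
    ∈lower⇒outer∈ : ∀ {i} s → i ∈ lower M → at i (outer s) ∈ M
    ∈lower⇒outer∈ s i∈ = ¬inner⇒outer s (outer⇒¬inner (lookup⇒[]= _ M (∈-tabulate⁻ _ i∈)))

    lift-lower : lift (lower M) ≡ M
    lift-lower = ⊆-antisym (λ k∈ → to (locate _) k∈) (λ k∈ → from (locate _) k∈)
      where
        to : ∀ {k} → Location k → k ∈ lift (lower M) → k ∈ M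
        to (located i (outer s)) k∈ = ∈lower⇒outer∈ s (outer∈lift⁻ (lower M) k∈)
        to (located i inner)     k∈ with at i inner ∈? M
        ... | yes i∈ = i∈
        ... | no i∉  = contradiction (outer∈⇒∈lower (¬inner⇒outer zero i∉)) (inner∈lift⁻ (lower M) k∈)
        from : ∀ {k} → Location k → k ∈ M → k ∈ lift (lower M)
        from (located i (outer s)) k∈ = outer∈lift⁺ (lower M) s (outer∈⇒∈lower k∈)
        from (located i inner)     k∈ = inner∈lift⁺ (lower M) λ i∈ → outer⇒¬inner (∈lower⇒outer∈ zero i∈) k∈

    -- Old vertices lie on outer edges only. A competing edge j at the same vertex has its own outer
    -- edge there in M, so uniqueness in M decides.
    lower-perfect : Perfect G (lower M)
    lower-perfect v with cover perfect (old v)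
    ... | i , p , i∈ , meets with old-meets refl meets
    ...   | s , refl , refl = i , (outer∈⇒∈lower i∈ , end⇒Incident i s) , only
      where
        only : ∀ {j} → j ∈ lower M × Incident G (ends i s) j → i ≡ j
        only {j} (j∈ , inc) with Incident⇒end inc
        ... | t , eq = cong proj₁ (unique-part perfect i∈ (atEnd i s) (∈lower⇒outer∈ t j∈)
                         (subst (λ u → Meets (old u) j (outer t)) (sym eq) (atEnd j t)))

  -- Forcing sets against anti-forcing sets

  forcing⇒antiForcing : ∀ {M F} → IsPerfectMatching G M → IsForcingSet G M F →
    IsAntiForcingSet G′ (lift M) (image (λ i → at i inner) F)
  forcing⇒antiForcing {M} {F} (_ , perfect) (F⊆M , forces) =
    disjoint , (avoids , lift-perfect perfect) , only
    where
      cut : EdgeSet G′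
      cut = image (λ i → at i inner) F

      disjoint : cut ⊆ ∁ (lift M)
      disjoint k∈ with ∈-image⁻ (λ i → at i inner) F k∈
      ... | i , i∈ , refl = x∉p⇒x∈∁p λ l∈ → inner∈lift⁻ M l∈ (F⊆M i∈)

      avoids : lift M ⊆ ∁ cut
      avoids l∈ = x∉p⇒x∈∁p λ k∈ → x∈∁p⇒x∉p (disjoint k∈) l∈

      only : ∀ N → IsPerfectMatchingIn G′ (∁ cut) N → N ≡ lift M
      only N (N⊆ , perfectN) = trans (sym (lift-lower perfectN))
        (cong lift (forces (lower N) (⊆⊤ , lower-perfect perfectN) F⊆lower))
        where
          F⊆lower : F ⊆ lower N
          -- The inner edge of i is cut, so N must contain both outer edges of its path.
          F⊆lower {i} i∈ = outer∈⇒∈lower perfectN (¬inner⇒outer perfectN zero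
            λ k∈ → x∈∁p⇒x∉p (N⊆ k∈) (∈-image⁺ (λ i → at i inner) i∈))

  -- The matching edge that forbids the given edge of the subdivision.
  guard : ∀ {M} → Perfect G M → Fin (size G) × Part → Fin (size G)
  guard perfect (i , outer s) = proj₁ (perfect (ends i s))
  guard perfect (i , inner)   = i

  -- If N contains all guards, its lift avoids A and hence equals M; lowering both gives N.
  antiForcing⇒forcing : ∀ {M A} (pm : IsPerfectMatching G′ M) → IsAntiForcingSet G′ M A →
    IsForcingSet G (lower M) (image (guard (lower-perfect (proj₂ pm)) ∘ unpos newEdge) A)
  antiForcing⇒forcing {M} {A} (_ , perfect) (A⊆ , _ , only) = F⊆ , forces
    where
      φ : Fin (size G′) → Fin (size G)
      φ = guard (lower-perfect perfect) ∘ unpos newEdge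

      φ-at : ∀ i p → φ (at i p) ≡ guard (lower-perfect perfect) (i , p)
      φ-at i p = cong (guard (lower-perfect perfect)) (unpos-pos newEdge i p)

      guard∈lower : ∀ {k} → Location k → k ∈ A → φ k ∈ lower M
      guard∈lower (located i (outer s)) k∈ rewrite φ-at i (outer s) =
        proj₁ (proj₁ (proj₂ (lower-perfect perfect (ends i s))))
      -- A avoids M, so the inner edge is missing from M and the outer edges are present.
      guard∈lower (located i inner) k∈ rewrite φ-at i inner =
        outer∈⇒∈lower perfect (¬inner⇒outer perfect zero (x∈∁p⇒x∉p (A⊆ k∈)))

      F⊆ : image φ A ⊆ lower M
      F⊆ i∈ with ∈-image⁻ φ A i∈
      ... | k , k∈ , refl = guard∈lower (locate k) k∈

      forces : ∀ N → IsPerfectMatching G N → image φ A ⊆ N → N ≡ lower M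
      forces N (_ , perfectN) F⊆N = trans (sym (lower-lift N))
        (cong lower (only (lift N) ((λ k∈ → x∉p⇒x∈∁p (avoids (locate _) k∈)) , lift-perfect perfectN)))
        where
          guard∈N : ∀ {i p} → at i p ∈ A → guard (lower-perfect perfect) (i , p) ∈ N
          guard∈N {i} {p} k∈ = subst (_∈ N) (φ-at i p) (F⊆N (∈-image⁺ φ k∈))

          avoids : ∀ {k} → Location k → k ∈ lift N → k ∉ A
          avoids (located i inner)     l∈ k∈ = inner∈lift⁻ N l∈ (guard∈N k∈)
          -- The guard j and i would both lie in N and share the vertex `ends i s`, so i = j. As j
          -- lies in `lower M`, the outer edge would lie in M, which A avoids.
          avoids (located i (outer s)) l∈ k∈ with lower-perfect perfect (ends i s) | guard∈N k∈
          ... | j , (j∈M , inc) , _ | j∈N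
            with unique-edge perfectN j∈N inc (outer∈lift⁻ N l∈) (end⇒Incident i s)
          ...   | refl = x∈∁p⇒x∉p (A⊆ k∈) (∈lower⇒outer∈ perfect s j∈M)

subdivide-correct : ∀ x → Yes ForcingPM x ⇔ Yes Anti-ForcingPM (map₁ subdivide x)
subdivide-correct (G , k) = mk⇔ to from
  where
    open Correctness G
    to : Yes ForcingPM (G , k) → Yes Anti-ForcingPM (subdivide G , k)
    to (M , pm , F , forcing , ∣F∣≤k) = lift M , (⊆⊤ , lift-perfect (proj₂ pm)) , _ ,
      forcing⇒antiForcing pm forcing , ≤-trans (∣image∣≤ _ F) ∣F∣≤k
    from : Yes Anti-ForcingPM (subdivide G , k) → Yes ForcingPM (G , k)
    from (M , pm , A , antiForcing , ∣A∣≤k) = lower M , (⊆⊤ , lower-perfect (proj₂ pm)) , _ ,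
      antiForcing⇒forcing pm antiForcing , ≤-trans (∣image∣≤ _ A) ∣A∣≤k

-- The machine

pattern start       = zero
pattern enter       = suc start
pattern readOrder   = suc enter
pattern readEdge    = suc readOrder
pattern copySrc     = suc readEdge
pattern scanRight₁  = suc copySrc
pattern mark₁       = suc scanRight₁
pattern scanLeft₁   = suc mark₁
pattern turn        = suc scanLeft₁
pattern scanRight₂  = suc turn
pattern mark₂       = suc scanRight₂
pattern copyTgt     = suc mark₂
pattern scanLeft₂   = suc copyTgt
pattern copyDigits  = suc scanLeft₂
pattern rewind      = suc copyDigits
pattern prepend     = suc rewind
pattern stop        = suc prepend

State : Set
State = Fin 17

Command : Set
Command = Maybe (State × Vec (Symbol × Move) 3)

infix 1 goto_∶_∣_∣_

goto_∶_∣_∣_ : State → (i c o : Symbol × Move) → Command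
goto q ∶ i ∣ c ∣ o = just (q , i ∷ c ∷ o ∷ [])

pattern 0▸ = just false , right
pattern 1▸ = just true , right
pattern ◂0 = just false , left
pattern ◂1 = just true , left

-- The block of ones on the counter grows at its left end: `scanLeft₁` and `scanLeft₂` each turn the
-- blank they reach into a 1. The four scans for an edge thus write c, c, c + 1, c + 1 and leave c +
-- 2.
δ : State → (i c o : Symbol) → Command
δ start i c o = goto enter ∶ i , left ∣ c , left ∣ o , stay
δ enter i c o = goto readOrder ∶ i , right ∣ c , stay ∣ o , stay
δ readOrder (just true)  c o = goto readOrder ∶ 1▸ ∣ ◂1 ∣ o , stay
δ readOrder (just false) c o = goto readEdge ∶ 0▸ ∣ c , stay ∣ o , stay
δ readOrder nothing c o = nothing
δ readEdge (just true)  c o = goto copySrc ∶ 1▸ ∣ c , stay ∣ 1▸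
δ readEdge (just false) c o = goto copyDigits ∶ 0▸ ∣ c , stay ∣ 0▸
δ readEdge nothing c o = nothing
δ copySrc (just true)  c o = goto copySrc ∶ 1▸ ∣ c , stay ∣ 1▸
δ copySrc (just false) c o = goto scanRight₁ ∶ 0▸ ∣ c , right ∣ 0▸
δ copySrc nothing c o = nothing
δ scanRight₁ i (just _) o = goto scanRight₁ ∶ i , stay ∣ 1▸ ∣ 1▸
δ scanRight₁ i nothing  o = goto mark₁ ∶ i , stay ∣ nothing , stay ∣ 0▸
δ mark₁ i c o = goto scanLeft₁ ∶ i , stay ∣ c , left ∣ 1▸
δ scanLeft₁ i (just _) o = goto scanLeft₁ ∶ i , stay ∣ ◂1 ∣ 1▸
δ scanLeft₁ i nothing  o = goto turn ∶ i , stay ∣ ◂1 ∣ 0▸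
δ turn i c o = goto scanRight₂ ∶ i , stay ∣ c , right ∣ o , stay
δ scanRight₂ i (just _) o = goto scanRight₂ ∶ i , stay ∣ 1▸ ∣ 1▸
δ scanRight₂ i nothing  o = goto mark₂ ∶ i , stay ∣ nothing , stay ∣ 0▸
δ mark₂ i c o = goto copyTgt ∶ i , stay ∣ c , stay ∣ 1▸
δ copyTgt (just true)  c o = goto copyTgt ∶ 1▸ ∣ c , stay ∣ 1▸
δ copyTgt (just false) c o = goto scanLeft₂ ∶ 0▸ ∣ c , left ∣ 0▸
δ copyTgt nothing c o = nothing
δ scanLeft₂ i (just _) o = goto scanLeft₂ ∶ i , stay ∣ ◂1 ∣ 1▸
δ scanLeft₂ i nothing  o = goto readEdge ∶ i , stay ∣ ◂1 ∣ 0▸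
δ copyDigits (just b) c o = goto copyDigits ∶ just b , right ∣ c , stay ∣ just b , right
δ copyDigits nothing  c o = goto rewind ∶ nothing , stay ∣ c , stay ∣ nothing , left
δ rewind i c (just b) = goto rewind ∶ i , stay ∣ c , stay ∣ just b , left
δ rewind i c nothing  = goto prepend ∶ i , stay ∣ c , right ∣ ◂0
δ prepend i (just _) o = goto prepend ∶ i , stay ∣ 1▸ ∣ ◂1
δ prepend i nothing  o = goto stop ∶ i , stay ∣ nothing , stay ∣ o , right
δ stop i c o = nothing

subdivider : TuringMachine
subdivider = record
  { extraTapes = 2
  ; State      = State
  ; stateCount = 17
  ; finite     = ↔-id State
  ; start      = start
  ; transition = λ { q (i ∷ c ∷ o ∷ []) → δ q i c o }
  }

open TuringMachine subdivider using (Config; perform; step; HaltsIn; done; next; initial; output)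

-- Runs of the machine with exact time and output

record Outputs (t : ℕ) (c : Config) (v : List Bool) : Set where
  constructor outputs
  field
    {final} : Config
    halts   : HaltsIn t c final
    result  : output final ≡ v

retime : ∀ {s t c v} → s ≡ t → Outputs s c v → Outputs t c v
retime refl k = k

later : ∀ {t c c′ v} → step c ≡ just c′ → Outputs t c′ v → Outputs (suc t) c v
later eq (outputs h out) = outputs (next eq h) out

prefix : ∀ {A : Set} → ℕ → A → List A → List A
prefix n x ys = replicate n x ++ ys

-- Needed because a moving head takes cells from one end of a block and rebuilds the block from the
-- other.
prefix-∷ : ∀ {A : Set} n (x : A) ys → prefix n x (x ∷ ys) ≡ x ∷ prefix n x ys
prefix-∷ zero    x ys = refl
prefix-∷ (suc n) x ys = cong (x ∷_) (prefix-∷ n x ys)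

prefix-unary : ∀ n w → prefix n true (false ∷ w) ≡ unary n w
prefix-unary zero    w = refl
prefix-unary (suc n) w = cong (true ∷_) (prefix-unary n w)

ones : ℕ → List Symbol → List Symbol
ones n = prefix n (just true)

-- Writing tapes as the result of a move makes the next configuration
-- have the same form definitionally.
reading : List Symbol → Symbol → List Bool → Tape
reading ls s w = move right (tape ls s (map just w))

written : List Bool → Tape
written o = tape (map just o) nothing []

-- The closing blank is listed explicitly: the machine first steps left of
-- cell 0, so that all later visits leave the lists of cells unchanged.
counter : ℕ → Tape
counter n = tape [] nothing (ones n (nothing ∷ []))

leadingBits-just : ∀ v → leadingBits (map just v ++ nothing ∷ []) ≡ v
leadingBits-just []      = refl
leadingBits-just (b ∷ v) = cong (b ∷_) (leadingBits-just v)

contents-final : ∀ v → contents (move right (tape [] nothing (map just v ++ nothing ∷ []))) ≡ v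
contents-final []      = refl
contents-final (b ∷ v) = cong (b ∷_) (leadingBits-just v)

-- Each 1 of the counter is copied to the left of the output; a final move right puts the head on
-- the first bit, where `contents` starts.
prepend-outputs : ∀ n {I} ls s v →
  Outputs (suc n) (prepend , I ∷ move right (tape ls s (ones n (nothing ∷ []))) ∷
                             tape [] nothing (map just v ++ nothing ∷ []) ∷ [])
    (prefix n true v)
prepend-outputs zero    ls s v = later refl (outputs (done refl) (contents-final v))
prepend-outputs (suc n) ls s v =
  later refl (subst (Outputs _ _) (prefix-∷ n true v) (prepend-outputs n (s ∷ ls) (just true) (true ∷ v)))

-- The blank left of the output receives the 0 that closes the unary order. The equation exposes the
-- first cell, which `move left` needs.
rewind-outputs : ∀ N {I} o s rs v → s ∷ rs ≡ map just v ++ nothing ∷ [] →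
  Outputs (suc (length o) + suc N)
    (rewind , I ∷ counter N ∷ move left (tape (map just o) s rs) ∷ [])
    (unary N (o ʳ++ v))
rewind-outputs N {I} [] s rs v eq = later refl
  (subst (λ zs → Outputs (suc N)
      (prepend , I ∷ move right (counter N) ∷ tape [] nothing (just false ∷ zs) ∷ []) (unary N v))
    (sym eq) (subst (Outputs _ _) (prefix-unary N v) (prepend-outputs N [] nothing (false ∷ v))))
rewind-outputs N (b ∷ o) s rs v eq =
  later refl (rewind-outputs N o (just b) (s ∷ rs) (b ∷ v) (cong (just b ∷_) eq))

-- N is the final value of the counter, r is what remains to be written.
-- The length of o pays for rewinding the output.
record Runs (N t : ℕ) (q : State) (w : List Bool) (C : Tape) (r : List Bool) : Set where
  constructor runs
  field
    run : ∀ ls s o →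
      Outputs (t + length o) (q , reading ls s w ∷ C ∷ written o ∷ []) (unary N (o ʳ++ r))

open Runs

private
  variable
    N t     : ℕ
    q q′    : State
    r w     : List Bool
    a b     : Bool
    C       : Tape
    x       : Symbol × Move
    dir     : Move

silent : (∀ i o → δ q i (current C) o ≡ (goto q′ ∶ i , stay ∣ x ∣ o , stay)) →
  Runs N t q′ w (act x C) r → Runs N (suc t) q w C r
silent {C = C} eq k = runs λ ls s o → later (cong (perform _) (eq _ _)) (run k ls s o)

consume : (∀ o → δ q (just a) (current C) o ≡ (goto q′ ∶ just a , right ∣ x ∣ o , stay)) →
  Runs N t q′ w (act x C) r → Runs N (suc t) q (a ∷ w) C r
consume eq k = runs λ ls s o → later (cong (perform _) (eq _)) (run k _ _ o)

-- A written bit costs two units: one for the step and one for rewinding over it at the end. The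
-- same holds for `transfer`.
emit : (∀ i o → δ q i (current C) o ≡ (goto q′ ∶ i , stay ∣ x ∣ just b , right)) →
  Runs N t q′ w (act x C) r → Runs N (2 + t) q w C (b ∷ r)
emit {t = t} eq k = runs λ ls s o → later (cong (perform _) (eq _ _))
  (retime (+-suc t (length o)) (run k ls s (_ ∷ o)))

transfer : (∀ o → δ q (just a) (current C) o ≡ (goto q′ ∶ just a , right ∣ x ∣ just b , right)) →
  Runs N t q′ w (act x C) r → Runs N (2 + t) q (a ∷ w) C (b ∷ r)
transfer {t = t} eq k = runs λ ls s o → later (cong (perform _) (eq _))
  (retime (+-suc t (length o)) (run k _ _ (_ ∷ o)))

-- Phases of the machine and the loop over the edges

copyDigits-runs : ∀ N w → Runs N (length w * 2 + (2 + suc N)) copyDigits w (counter N) w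
copyDigits-runs N [] = runs λ ls s o →
  -- The 2 in the time counts the step into `rewind` and the step on the blank left of the output;
  -- `prepend` takes the remaining N + 1.
  later refl (retime (cong suc (+-comm (length o) (suc N)))
    (rewind-outputs N o nothing [] [] refl))
copyDigits-runs N (b ∷ w) = transfer (λ _ → refl) (copyDigits-runs N w)

Copies : State → State → Move → Set
Copies q q′ dir =
  (∀ c o → δ q (just true)  c o ≡ (goto q ∶ 1▸ ∣ c , stay ∣ 1▸)) ×
  (∀ c o → δ q (just false) c o ≡ (goto q′ ∶ 0▸ ∣ c , dir ∣ 0▸))

copy-runs : Copies q q′ dir → ∀ n →
  Runs N t q′ w (move dir C) r → Runs N (suc n * 2 + t) q (unary n w) C (unary n r)
copy-runs (_ , end) zero k = transfer (end _) k
copy-runs copies@(loop , _) (suc n) k = transfer (loop _) (copy-runs copies n k)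

-- The scheme shared by the four scans; x is the action on the blank that ends the block, which
-- increments the counter in the leftward scans only.
Scans : State → State → Move → Symbol × Move → Set
Scans q q′ dir x =
  (∀ i b o → δ q i (just b) o ≡ (goto q ∶ i , stay ∣ just true , dir ∣ 1▸)) ×
  (∀ i o → δ q i nothing  o ≡ (goto q′ ∶ i , stay ∣ x ∣ 0▸))

scanRight-runs : Scans q q′ right x → ∀ n {c ls rs} →
  Runs N t q′ w (act x (tape (ones n (c ∷ ls)) nothing rs)) r →
  Runs N (suc n * 2 + t) q w (move right (tape ls c (ones n (nothing ∷ rs)))) (unary n r)
scanRight-runs (_ , end) zero k = emit end k
scanRight-runs {q′ = q′} {x = x} {N = N} {t} {w} {r} scans@(loop , _) (suc n) {c} {ls} {rs} k =
  emit (λ i → loop i true)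
  (scanRight-runs scans n
    (subst (λ zs → Runs N t q′ w (act x (tape zs nothing rs)) r)
      (sym (prefix-∷ n (just true) (c ∷ ls))) k))

scanLeft-runs : Scans q q′ left x → ∀ n {c ls rs} →
  Runs N t q′ w (act x (tape ls nothing (ones n (c ∷ rs)))) r →
  Runs N (suc n * 2 + t) q w (move left (tape (ones n (nothing ∷ ls)) c rs)) (unary n r)
scanLeft-runs (_ , end) zero k = emit end k
scanLeft-runs {q′ = q′} {x = x} {N = N} {t} {w} {r} scans@(loop , _) (suc n) {c} {ls} {rs} k =
  emit (λ i → loop i true)
  (scanLeft-runs scans n
    (subst (λ zs → Runs N t q′ w (act x (tape ls nothing zs)) r)
      (sym (prefix-∷ n (just true) (c ∷ rs))) k))

-- The summands follow the phases for one edge in order, two per written bit; the 1 is the step of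
-- `turn`, which writes no output.
edgesTime : ∀ {n} → ℕ → List (Edge n) → ℕ → ℕ
edgesTime c []       t = 2 + t
edgesTime c (e ∷ es) t =
  2 + (suc (toℕ (src e)) * 2 + (suc c * 2 + (2 + (suc c * 2 + (1 + (suc (suc c) * 2 + (2 +
  (suc (toℕ (tgt e)) * 2 + (suc (suc c) * 2 + edgesTime (2 + c) es t)))))))))

-- Link between machine and encoding: the edge code of the subdivision with new vertices numbered
-- from c, in the form in which the machine emits it.
subdivided : ∀ {n} → ℕ → List (Edge n) → List Bool → List Bool
subdivided c []       w = false ∷ w
subdivided c (e ∷ es) w =
  true ∷ unary (toℕ (src e)) (unary c (
  true ∷ unary c (unary (1 + c) (
  true ∷ unary (toℕ (tgt e)) (unary (1 + c) (subdivided (2 + c) es w))))))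

shift : ∀ c m {N} → c + suc m * 2 ≡ N → 2 + c + m * 2 ≡ N
shift c m eq = trans (swap c (m * 2)) eq
  where
    swap : ∀ c d → 2 + c + d ≡ c + (2 + d)
    swap = solve-∀

readEdge-runs : ∀ {n} c (es : List (Edge n)) → c + length es * 2 ≡ N →
  Runs N t copyDigits w (counter N) r →
  Runs N (edgesTime c es t) readEdge (encodeEdges es w) (counter c) (subdivided c es r)
readEdge-runs c []       refl k rewrite +-identityʳ c = transfer (λ _ → refl) k
readEdge-runs c (e ∷ es) eq   k =
  transfer (λ _ → refl)
  (copy-runs ((λ _ _ → refl) , λ _ _ → refl) (toℕ (src e))
  (scanRight-runs {q′ = mark₁} ((λ _ _ _ → refl) , λ _ _ → refl) c
  (emit (λ _ _ → refl)
  (scanLeft-runs {q′ = turn} ((λ _ _ _ → refl) , λ _ _ → refl) c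
  (silent (λ _ _ → refl)
  -- The preceding leftward scan has raised the counter to `suc c`.
  (scanRight-runs {q′ = mark₂} ((λ _ _ _ → refl) , λ _ _ → refl) (suc c)
  (emit (λ _ _ → refl)
  (copy-runs ((λ _ _ → refl) , λ _ _ → refl) (toℕ (tgt e))
  (scanLeft-runs {q′ = readEdge} ((λ _ _ _ → refl) , λ _ _ → refl) (suc c)
  (readEdge-runs (2 + c) es (shift c (length es) eq) k))))))))))

-- Quantifying the continuation over c′ avoids transporting runs between `c + suc n` and
-- `suc c + n`.
readOrder-runs : ∀ n c → (∀ {c′} → c + n ≡ c′ → Runs N t readEdge w (counter c′) r) →
  Runs N (suc n + t) readOrder (unary n w) (counter c) r
readOrder-runs zero    c k = consume (λ _ → refl) (k (+-identityʳ c))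
readOrder-runs (suc n) c k = consume (λ _ → refl) (readOrder-runs n (suc c) λ eq → k (trans (+-suc c n) eq))

start-outputs : ∀ a w → Runs N t readOrder (a ∷ w) (counter 0) r →
  Outputs (2 + (t + 0)) (initial (a ∷ w)) (unary N r)
start-outputs a w k = later refl (later refl (run k [] nothing []))

-- The leading 2 counts `start` and `enter`; the final 0 is the length of the output, still empty at
-- that point.
runTime : ∀ {n} → ℕ → List (Edge n) → List Bool → ℕ
runTime n es w = 2 + ((suc n + edgesTime n es (length w * 2 + (2 + suc (n + length es * 2)))) + 0)

subdivider-outputs : ∀ n (es : List (Edge n)) w →
  Outputs (runTime n es w) (initial (unary n (encodeEdges es w)))
    (unary (n + length es * 2) (subdivided n es w))
subdivider-outputs n es w = go n edges-run
  where
    edges-run : ∀ {c} → n ≡ c →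
      Runs (n + length es * 2) _ readEdge (encodeEdges es w) (counter c) (subdivided n es w)
    edges-run refl = readEdge-runs n es refl (copyDigits-runs _ w)
    go : ∀ m {w N t r} → (∀ {c} → m ≡ c → Runs N t readEdge w (counter c) r) →
      Outputs (2 + (suc m + t + 0)) (initial (unary m w)) (unary N r)
    -- `inputTape` distinguishes the empty word, so the first bit of the unary code has to be
    -- exposed.
    go zero    k = start-outputs false _ (readOrder-runs 0 0 k)
    go (suc m) k = start-outputs true _ (readOrder-runs (suc m) 0 k)

-- The output is the code of the subdivided graph

slide-new : ∀ c i s → c + (2 * suc i + s) ≡ 2 + c + (2 * i + s)
slide-new = solve-∀

-- Stated for any h with the right vertex numbers, since the tail of the list is given by `h ∘ suc`,
-- whose new vertices are numbered from 2 + c.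
encodeEdges-flatten : ∀ {n N} c (es : List (Edge n)) (h : Fin (length es) → Part → Edge N) w →
  (∀ i s → toℕ (src (h i (outer s))) ≡ toℕ (end (lookup es i) s)) →
  (∀ i s → toℕ (tgt (h i (outer s))) ≡ c + (2 * toℕ i + toℕ s)) →
  (∀ i s → toℕ (end (h i inner) s) ≡ c + (2 * toℕ i + toℕ s)) →
  encodeEdges (flatten h) w ≡ subdivided c es w
encodeEdges-flatten c []       h w old new new′ = refl
encodeEdges-flatten c (e ∷ es) h w old new new′
  rewrite old zero zero | old zero (suc zero)
        | new zero zero | new zero (suc zero) | new′ zero zero | new′ zero (suc zero)
        | +-identityʳ c | +-comm c 1
        | encodeEdges-flatten (2 + c) es (h ∘ suc) w (old ∘ suc)
            (λ i s → trans (new (suc i) s) (slide-new c (toℕ i) (toℕ s)))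
            (λ i s → trans (new′ (suc i) s) (slide-new c (toℕ i) (toℕ s))) = refl

encode-subdivide : ∀ G k → encodeGraph×ℕ (subdivide G , k) ≡
  unary (order G + size G * 2) (subdivided (order G) (edges G) (digits (fromℕ k)))
encode-subdivide (graph n es _) k = cong (unary _) (encodeEdges-flatten n es newEdge _
  (λ i s → toℕ-↑ˡ _ _) toℕ-new λ { i zero → toℕ-new i zero ; i (suc zero) → toℕ-new i (suc zero) })
  where open Subdivision es

-- The running time

length-unary : ∀ n w → length (unary n w) ≡ suc n + length w
length-unary zero    w = refl
length-unary (suc n) w = cong suc (length-unary n w)

-- Each bit of the code pays for 8(N + 1) units: an edge has 3 + u + v bits, its phases cost 23 +
-- 2(u + v) + 8c, and c ≤ N.
edgesTime-≤ : ∀ {n N} c (es : List (Edge n)) t w → c + length es * 2 ≡ N →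
  edgesTime c es t ≤ t + length (encodeEdges es w) * (8 * suc N)
edgesTime-≤ {N = N} c [] t w _ = begin
  2 + t                              ≤⟨ m≤m+n _ _ ⟩
  2 + t + (6 + 8 * N + length w * (8 * suc N)) ≡⟨ expand t (length w) N ⟩
  t + suc (length w) * (8 * suc N)   ∎
  where
    open ≤-Reasoning
    expand : ∀ t l N → 2 + t + (6 + 8 * N + l * (8 * suc N)) ≡ t + suc l * (8 * suc N)
    expand = solve-∀
edgesTime-≤ c (e ∷ es) t w refl = begin
  edgesTime c (e ∷ es) t
    ≡⟨ collect u v c (edgesTime (2 + c) es t) ⟩
  23 + 2 * (u + v) + 8 * c + edgesTime (2 + c) es t
    ≤⟨ +-monoʳ-≤ (23 + 2 * (u + v) + 8 * c) (edgesTime-≤ (2 + c) es t w (shift c (length es) refl)) ⟩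
  23 + 2 * (u + v) + 8 * c + (t + l * (8 * suc (c + d)))
    ≤⟨ m≤m+n _ _ ⟩
  23 + 2 * (u + v) + 8 * c + (t + l * (8 * suc (c + d))) +
    -- The exact slack of the bound, so that an identity for the ring solver remains.
    (1 + 6 * (u + v) + 16 * c + 24 * d + 8 * (u + v) * (c + d))
    ≡⟨ expand u v c d t l ⟩
  t + (3 + (u + v) + l) * (8 * suc (c + d))
    ≡⟨ cong (λ k → t + k * (8 * suc (c + d))) edge-length ⟨
  t + length (encodeEdges (e ∷ es) w) * (8 * suc (c + d)) ∎
  where
    open ≤-Reasoning
    u = toℕ (src e)
    v = toℕ (tgt e)
    d = suc (length es) * 2
    l = length (encodeEdges es w)
    collect : ∀ u v c t → 2 + (suc u * 2 + (suc c * 2 + (2 + (suc c * 2 + (1 + (suc (suc c) * 2 + (2 +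
      (suc v * 2 + (suc (suc c) * 2 + t))))))))) ≡ 23 + 2 * (u + v) + 8 * c + t
    collect = solve-∀
    expand : ∀ u v c d t l → 23 + 2 * (u + v) + 8 * c + (t + l * (8 * suc (c + d))) +
      (1 + 6 * (u + v) + 16 * c + 24 * d + 8 * (u + v) * (c + d)) ≡ t + (3 + (u + v) + l) * (8 * suc (c + d))
    expand = solve-∀
    regroup : ∀ u v l → 1 + (suc u + (suc v + l)) ≡ 3 + (u + v) + l
    regroup = solve-∀
    edge-length : length (encodeEdges (e ∷ es) w) ≡ 3 + (u + v) + l
    edge-length =
      trans (cong suc (trans (length-unary u _) (cong (suc u +_) (length-unary v _)))) (regroup u v l)

-- An edge takes at least three bits and the end mark one. This bounds the number of new vertices
-- and the digits of k by the input length.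
encodeEdges-≥ : ∀ {n} (es : List (Edge n)) w → suc (length w + length es * 2) ≤ length (encodeEdges es w)
encodeEdges-≥ []       w rewrite +-identityʳ (length w) = ≤-refl
encodeEdges-≥ (e ∷ es) w
  rewrite length-unary (toℕ (src e)) (unary (toℕ (tgt e)) (encodeEdges es w))
        | length-unary (toℕ (tgt e)) (encodeEdges es w) = begin
  suc (length w + (2 + length es * 2)) ≡⟨ cong suc (swap (length w) (length es * 2)) ⟩
  3 + (length w + length es * 2)       ≤⟨ +-monoʳ-≤ 2 (encodeEdges-≥ es w) ⟩
  2 + length (encodeEdges es w)        ≤⟨ s≤s (s≤s (m≤n+m _ (toℕ (tgt e)))) ⟩
  2 + (toℕ (tgt e) + length (encodeEdges es w))
    ≤⟨ s≤s (s≤s (≤-trans (n≤1+n _) (m≤n+m _ (toℕ (src e))))) ⟩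
  _ ∎
  where
    open ≤-Reasoning
    swap : ∀ l d → l + (2 + d) ≡ 2 + (l + d)
    swap = solve-∀

runTime-≤ : ∀ n (es : List (Edge n)) w → let L = length (unary n (encodeEdges es w)) in
  runTime n es w ≤ 24 * L ^ 2 + 24
runTime-≤ n es w rewrite length-unary n (encodeEdges es w) = begin
  2 + ((suc n + edgesTime n es T) + 0)
    ≤⟨ +-monoʳ-≤ 2 (+-monoˡ-≤ 0 (+-mono-≤ n<L (edgesTime-≤ n es T w refl))) ⟩
  2 + ((L + (l * 2 + (2 + suc K) + E * (8 * suc K))) + 0)
    ≤⟨ +-monoʳ-≤ 2 (+-monoˡ-≤ 0 (+-monoʳ-≤ L (+-mono-≤
         (+-mono-≤ (*-monoˡ-≤ 2 l≤L) (+-monoʳ-≤ 3 K≤L)) (*-mono-≤ E≤L (*-monoʳ-≤ 8 (s≤s K≤L)))))) ⟩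
  2 + ((L + (L * 2 + (2 + suc L) + L * (8 * suc L))) + 0)
    ≡⟨ collect L ⟩
  8 * (L * L) + 12 * L + 5
    -- L is a successor, so L ≤ L * L.
    ≤⟨ +-mono-≤ (+-monoʳ-≤ (8 * (L * L)) (*-monoʳ-≤ 12 (m≤m*n L L))) (m≤m+n 5 19) ⟩
  8 * (L * L) + 12 * (L * L) + 24
    -- Rounding 20 up to 24 lets one constant serve as factor and as summand, as
    -- `PolyTimeComputable` asks.
    ≤⟨ +-monoˡ-≤ 24 (m≤m+n (8 * (L * L) + 12 * (L * L)) (4 * (L * L))) ⟩
  8 * (L * L) + 12 * (L * L) + 4 * (L * L) + 24
    ≡⟨ factor L ⟩
  24 * L ^ 2 + 24 ∎
  where
    open ≤-Reasoning
    l = length w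
    E = length (encodeEdges es w)
    L = suc n + E
    K = n + length es * 2
    T = l * 2 + (2 + suc K)
    n<L : suc n ≤ L
    n<L = m≤m+n _ _
    E≤L : E ≤ L
    E≤L = m≤n+m E (suc n)
    l≤L : l ≤ L
    l≤L = ≤-trans (≤-trans (m≤n⇒m≤1+n (m≤m+n l _)) (encodeEdges-≥ es w)) E≤L
    K≤L : K ≤ L
    K≤L = +-mono-≤ (n≤1+n n) (≤-trans (m≤n⇒m≤1+n (m≤n+m _ l)) (encodeEdges-≥ es w))
    collect : ∀ L → 2 + ((L + (L * 2 + (2 + suc L) + L * (8 * suc L))) + 0) ≡ 8 * (L * L) + 12 * L + 5
    collect = solve-∀
    factor : ∀ L → 8 * (L * L) + 12 * (L * L) + 4 * (L * L) + 24 ≡ 24 * (L * (L * 1)) + 24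
    factor = solve-∀

theorem2 : ForcingPM ≤ᵖ Anti-ForcingPM
theorem2 = map₁ subdivide , (subdivider , 24 , 2 , computes) , subdivide-correct
  where
    computes : ∀ x → TuringMachine.OutputsWithin subdivider
      (24 * length (encodeGraph×ℕ x) ^ 2 + 24) (encodeGraph×ℕ x) (encodeGraph×ℕ (map₁ subdivide x))
    computes (G , k) with subdivider-outputs (order G) (edges G) (digits (fromℕ k))
    ... | outputs halts result =
      _ , _ , runTime-≤ (order G) (edges G) (digits (fromℕ k)) , halts ,
      trans result (sym (encode-subdivide G k))
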